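{- For every $n\ge 2$ the Sierpinski gasket graph $S_n$ is a fractal, with $\dim_L(S_n)=1$ and $\dim_H(S_n)=2$.
   Context: Sierpinski gasket graphs: define tetrads $T_n=(S_n,x_1,x_2,x_3)$, where $S_n$ is a graph and $x_1,x_2,x_3$ are distinct vertices of $S_n$ called contact vertices. $S_1$ is the triangle $K_3$ with vertices $x_1,x_2,x_3$, and $T_1=(S_1,x_1,x_2,x_3)$. The graph $S_{n+1}$ is obtained from three disjoint copies $(S_n,x_1,x_2,x_3)$, $(S'_n,x'_1,x'_2,x'_3)$, $(S''_n,x''_1,x''_2,x''_3)$ of $T_n$ by identifying $x_2$ with $x'_1$, $x'_3$ with $x''_2$, and $x_3$ with $x''_1$; and $T_{n+1}=(S_{n+1},x_1,x'_2,x''_3)$. A clique $k$-cover of a graph $G$ is a family of cliques of $G$ such that every edge of $G$ lies in at least one of them and every vertex belongs to at most $k$ of them. The rank dimension $\dim_R(G)$ is the minimal positive integer $k$ such that $G$ has a clique $k$-cover. The categorical product $G_1\times G_2$ has vertex set $V(G_1)\times V(G_2)$, with $(u_1,u_2),(v_1,v_2)$ adjacent iff $u_1v_1\in E(G_1)$ and $u_2v_2\in E(G_2)$. The Prague dimension $\dim_P(H)$ is the minimal positive integer $d$ such that $H$ is isomorphic to an induced subgraph of a categorical product of $d$ complete graphs. Put $\dim_L(G)=\dim_R(G)-1$ and $\dim_H(G)=\dim_P(\overline{G})-1$, where $\overline G$ is the complement of $G$. A graph $G$ is a fractal if $\dim_L(G)<\dim_H(G)$. -}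

module Defs where

open import Data.Bool.Base using (Bool; T)
open import Data.Bool.Properties using (T?)
open import Data.Fin.Base using (Fin)
open import Data.Fin.Properties as Fin using ()
open import Data.Fin.Subset using (Subset; ∣_∣)
open import Data.List.Base using (List; []; _∷_; allFin; cartesianProduct)
open import Data.List.Membership.Propositional.Properties using (∈-allFin)
open import Data.List.NonEmpty as List⁺ using (List⁺; foldr₁)
open import Data.List.Relation.Unary.Any as Any using (Any; here; there)
open import Data.List.Relation.Unary.Enumerates.Setoid using (IsEnumeration)
open import Data.List.Relation.Unary.Enumerates.Setoid.Properties using (cartesianProduct⁺)
open import Data.Nat.Base using (ℕ; suc; NonZero; _∸_; _≤_; _<_)
open import Data.Product.Base using (Σ-syntax; ∃-syntax; _×_; _,_; proj₁; proj₂)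
open import Data.Product.Relation.Binary.Pointwise.NonDependent using (×-decSetoid)
open import Data.Sum.Base using (_⊎_; inj₁; inj₂)
open import Data.Vec.Base using (tabulate)
open import Function.Base using (_∘_; _on_)
open import Function.Bundles using (Func; Inverse; _⇔_)
open import Level using (0ℓ)
open import Relation.Binary.Bundles using (Setoid; DecSetoid)
open import Relation.Binary.Construct.On as On using ()
open import Relation.Binary.Core using (Rel)
open import Relation.Binary.Definitions
  using (Decidable; Irreflexive; Symmetric; _Respects_; _Respects₂_)
open import Relation.Binary.PropositionalEquality as ≡ using (_≡_; _≢_; refl)
open import Relation.Nullary using (¬_; Dec; yes; no; ¬?; _×-dec_; _⊎-dec_; contradiction)
open import Relation.Nullary.Decidable as Dec using ()
open import Relation.Unary as Unary using (Pred)

-- Finite simple graphs.  Vertices form a setoid because the gasket graphs are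
-- built by identifying vertices, i.e. as quotients.
record Graph : Set₁ where
  field
    vertices : DecSetoid 0ℓ 0ℓ

  open DecSetoid vertices public
    using (_≈_; _≟_; setoid)
    renaming (Carrier to Vertex; refl to ≈-refl; sym to ≈-sym; trans to ≈-trans)

  field
    enumeration   : List Vertex
    isEnumeration : IsEnumeration setoid enumeration
    Adj           : Rel Vertex 0ℓ
    Adj-resp      : Adj Respects₂ _≈_
    Adj-sym       : Symmetric Adj
    Adj-irrefl    : Irreflexive _≈_ Adj
    Adj?          : Decidable Adj

  any-vertex? : {P : Pred Vertex 0ℓ} → P Respects _≈_ →
                Unary.Decidable P → Dec (Σ[ v ∈ Vertex ] P v)
  any-vertex? resp P? = Dec.map′ Any.satisfied
    (λ (v , p) → Any.map (λ v≈w → resp v≈w p) (isEnumeration v))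
    (Any.any? P? enumeration)

open Graph using (Vertex)

infix 4 _≅_

record _≅_ (G H : Graph) : Set where
  private
    module G = Graph G
    module H = Graph H
  field
    bijection : Inverse G.setoid H.setoid
    adjacency : ∀ u v → G.Adj u v ⇔ H.Adj (Inverse.to bijection u) (Inverse.to bijection v)

-- Sets of vertices, given by their characteristic functions.
VertexSet : Graph → Set
VertexSet G = Func (Graph.setoid G) (≡.setoid Bool)

infix 4 _∈ᵥ_

_∈ᵥ_ : {S : Setoid 0ℓ 0ℓ} → Setoid.Carrier S → Func S (≡.setoid Bool) → Set
v ∈ᵥ U = T (Func.to U v)

complete : ℕ → Graph
complete m = record
  { vertices      = Fin.≡-decSetoid m
  ; enumeration   = allFin m
  ; isEnumeration = ∈-allFin
  ; Adj           = _≢_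
  ; Adj-resp      = ≡.resp₂ _≢_
  ; Adj-sym       = ≡.≢-sym
  ; Adj-irrefl    = λ i≡j i≢j → i≢j i≡j
  ; Adj?          = λ i j → ¬? (i Fin.≟ j)
  }

complement : Graph → Graph
complement G = record
  { vertices      = vertices
  ; enumeration   = enumeration
  ; isEnumeration = isEnumeration
  ; Adj           = λ u v → ¬ u ≈ v × ¬ Adj u v
  ; Adj-resp      =
      (λ v≈w (u≉v , ¬uv) → (λ u≈w → u≉v (≈-trans u≈w (≈-sym v≈w)))
                         , (λ uw → ¬uv (proj₁ Adj-resp (≈-sym v≈w) uw)))
    , (λ u≈w (u≉v , ¬uv) → (λ w≈v → u≉v (≈-trans u≈w w≈v))
                         , (λ wv → ¬uv (proj₂ Adj-resp (≈-sym u≈w) wv)))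
  ; Adj-sym       = λ (u≉v , ¬uv) → u≉v ∘ ≈-sym , ¬uv ∘ Adj-sym
  ; Adj-irrefl    = λ u≈v (u≉v , _) → u≉v u≈v
  ; Adj?          = λ u v → ¬? (u ≟ v) ×-dec ¬? (Adj? u v)
  }
  where open Graph G

infixr 7 _×ᶜ_

-- The categorical product.
_×ᶜ_ : Graph → Graph → Graph
G ×ᶜ H = record
  { vertices      = ×-decSetoid G.vertices H.vertices
  ; enumeration   = cartesianProduct G.enumeration H.enumeration
  ; isEnumeration = cartesianProduct⁺ G.setoid H.setoid G.isEnumeration H.isEnumeration
  ; Adj           = λ (u₁ , u₂) (v₁ , v₂) → G.Adj u₁ v₁ × H.Adj u₂ v₂
  ; Adj-resp      =
      (λ (e , f) (a , b) → proj₁ G.Adj-resp e a , proj₁ H.Adj-resp f b)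
    , (λ (e , f) (a , b) → proj₂ G.Adj-resp e a , proj₂ H.Adj-resp f b)
  ; Adj-sym       = λ (a , b) → G.Adj-sym a , H.Adj-sym b
  ; Adj-irrefl    = λ (e , _) (a , _) → G.Adj-irrefl e a
  ; Adj?          = λ (u₁ , u₂) (v₁ , v₂) → G.Adj? u₁ v₁ ×-dec H.Adj? u₂ v₂
  }
  where
    module G = Graph G
    module H = Graph H

induced : (G : Graph) → VertexSet G → Graph
induced G U = record
  { vertices      = On.decSetoid vertices inc
  ; enumeration   = restrict enumeration
  ; isEnumeration = λ (v , v∈U) → restrict⁺ v∈U (isEnumeration v)
  ; Adj           = Adj on inc
  ; Adj-resp      = proj₁ Adj-resp , proj₂ Adj-resp
  ; Adj-sym       = Adj-sym
  ; Adj-irrefl    = Adj-irrefl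
  ; Adj?          = λ (u , _) (v , _) → Adj? u v
  }
  where
    open Graph G hiding (Vertex)

    Member : Set
    Member = Σ[ v ∈ Vertex G ] v ∈ᵥ U

    inc : Member → Vertex G
    inc = proj₁

    restrict : List (Vertex G) → List Member
    restrict []       = []
    restrict (v ∷ vs) with T? (Func.to U v)
    ... | yes v∈U = (v , v∈U) ∷ restrict vs
    ... | no  _   = restrict vs

    restrict⁺ : ∀ {v vs} → v ∈ᵥ U → Any (v ≈_) vs →
                Any (λ w → v ≈ inc w) (restrict vs)
    restrict⁺ {vs = w ∷ ws} v∈U v∈vs with T? (Func.to U w) | v∈vs
    ... | yes _   | here v≈w   = here v≈w
    ... | yes _   | there v∈ws = there (restrict⁺ v∈U v∈ws)
    ... | no  w∉U | here v≈w   = contradiction (≡.subst T (Func.cong U v≈w) v∈U) w∉U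
    ... | no  _   | there v∈ws = restrict⁺ v∈U v∈ws

IsClique : (G : Graph) → VertexSet G → Set
IsClique G C = ∀ {u v} → u ∈ᵥ C → v ∈ᵥ C → ¬ u ≈ v → Adj u v
  where open Graph G

record CliqueCover (G : Graph) (k : ℕ) : Set where
  open Graph G using (Adj)
  field
    size     : ℕ
    clique   : Fin size → VertexSet G
    isClique : ∀ i → IsClique G (clique i)

  cliquesThrough : Vertex G → Subset size
  cliquesThrough v = tabulate (λ i → Func.to (clique i) v)

  field
    covers  : ∀ {u v} → Adj u v →
              ∃[ i ] (u ∈ᵥ (clique i) × v ∈ᵥ (clique i))
    bounded : ∀ v → ∣ cliquesThrough v ∣ ≤ k

InducedInProduct : Graph → ℕ → Set
InducedInProduct H d =
  Σ[ ms ∈ List⁺ ℕ ] List⁺.length ms ≡ d ×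
    (let P = foldr₁ _×ᶜ_ (List⁺.map complete ms) in
     Σ[ U ∈ VertexSet P ] H ≅ induced P U)

IsLeastPositive : Pred ℕ 0ℓ → Pred ℕ 0ℓ
IsLeastPositive P k = 0 < k × P k × (∀ j → 0 < j → P j → k ≤ j)

-- The dimensions are minima over undecided predicates, so "the dimension of G
-- is k" is stated as a relation; k is unique by minimality.
IsDimR : Graph → ℕ → Set
IsDimR G = IsLeastPositive (CliqueCover G)

IsDimP : Graph → ℕ → Set
IsDimP G = IsLeastPositive (InducedInProduct G)

-- Truncated subtraction is exact here, as k is positive.
IsDimL : Graph → ℕ → Set
IsDimL G l = ∃[ k ] (IsDimR G k × l ≡ k ∸ 1)

IsDimH : Graph → ℕ → Set
IsDimH G h = ∃[ k ] (IsDimP (complement G) k × h ≡ k ∸ 1)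

IsFractal : Graph → Set
IsFractal G = ∃[ l ] ∃[ h ] (IsDimL G l × IsDimH G h × l < h)

-- A graph with three distinct contact vertices x₁, x₂, x₃, indexed by Fin 3.
record Tetrad : Set₁ where
  field
    graph    : Graph
    contact  : Fin 3 → Vertex graph
    distinct : ∀ {i j} → Graph._≈_ graph (contact i) (contact j) → i ≡ j

triangle : Tetrad
triangle = record { graph = complete 3 ; contact = λ i → i ; distinct = λ i≡j → i≡j }

module Glue (𝒯 : Tetrad) where
  open Tetrad 𝒯
  open Graph graph hiding (Vertex)

  -- (i , v) is the vertex v of the i-th of the three copies.
  Copies : Set
  Copies = Fin 3 × Vertex graph

  -- Contact j of copy i is identified with contact i of copy j.  Numbering the
  -- copies S, S′, S″ as 1, 2, 3, these are the identifications x₂ = x₁′,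
  -- x₃ = x₁″ and x₃′ = x₂″; the instances with i = j identify nothing new.
  data _∼_ : Rel Copies 0ℓ where
    same  : ∀ {i u v} → u ≈ v → (i , u) ∼ (i , v)
    glued : ∀ {i j u v} → u ≈ contact j → v ≈ contact i → (i , u) ∼ (j , v)

  ∼-refl : ∀ {p} → p ∼ p
  ∼-refl = same ≈-refl

  ∼-sym : Symmetric _∼_
  ∼-sym (same e)    = same (≈-sym e)
  ∼-sym (glued e f) = glued f e

  ∼-trans : ∀ {p q r} → p ∼ q → q ∼ r → p ∼ r
  ∼-trans (same e)    (same e′)     = same (≈-trans e e′)
  ∼-trans (same e)    (glued e′ f′) = glued (≈-trans e e′) f′
  ∼-trans (glued e f) (same e′)     = glued e (≈-trans (≈-sym e′) f)
  ∼-trans (glued e f) (glued e′ f′) with refl ← distinct (≈-trans (≈-sym f) e′) =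
    same (≈-trans e (≈-sym f′))

  ∼-copy : ∀ {i u v} → (i , u) ∼ (i , v) → u ≈ v
  ∼-copy (same e)    = e
  ∼-copy (glued e f) = ≈-trans e (≈-sym f)

  infix 4 _∼?_

  _∼?_ : Decidable _∼_
  (i , u) ∼? (j , v) = Dec.map′ to from
    ((i Fin.≟ j ×-dec u ≟ v) ⊎-dec (u ≟ contact j ×-dec v ≟ contact i))
    where
      to : (i ≡ j × u ≈ v) ⊎ (u ≈ contact j × v ≈ contact i) → (i , u) ∼ (j , v)
      to (inj₁ (refl , e)) = same e
      to (inj₂ (e , f))    = glued e f
      from : (i , u) ∼ (j , v) → (i ≡ j × u ≈ v) ⊎ (u ≈ contact j × v ≈ contact i)
      from (same e)    = inj₁ (refl , e)
      from (glued e f) = inj₂ (e , f)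

  gluedVertices : DecSetoid 0ℓ 0ℓ
  gluedVertices = record
    { Carrier          = Copies
    ; _≈_              = _∼_
    ; isDecEquivalence = record
      { isEquivalence = record { refl = ∼-refl ; sym = ∼-sym ; trans = ∼-trans }
      ; _≟_           = _∼?_
      }
    }

  -- Two vertices are adjacent when they have representatives that are adjacent
  -- in one of the copies.
  GluedAdj : Rel Copies 0ℓ
  GluedAdj p q = ∃[ k ] ∃[ u ] ∃[ v ] (p ∼ (k , u) × q ∼ (k , v) × Adj u v)

  GluedAdj? : Decidable GluedAdj
  GluedAdj? p q = Fin.any? λ k →
    any-vertex?
      (λ { u≈u′ (v , p∼ , q∼ , uv) →
           v , ∼-trans p∼ (same u≈u′) , q∼ , proj₂ Adj-resp u≈u′ uv })
      λ u → any-vertex?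
        (λ { v≈v′ (p∼ , q∼ , uv) →
             p∼ , ∼-trans q∼ (same v≈v′) , proj₁ Adj-resp v≈v′ uv })
        λ v → p ∼? (k , u) ×-dec q ∼? (k , v) ×-dec Adj? u v

  gluedGraph : Graph
  gluedGraph = record
    { vertices      = gluedVertices
    ; enumeration   = cartesianProduct (allFin 3) enumeration
    ; isEnumeration = λ p → Any.map (λ { (refl , e) → same e })
        (cartesianProduct⁺ (≡.setoid (Fin 3)) setoid ∈-allFin isEnumeration p)
    ; Adj           = GluedAdj
    ; Adj-resp      =
        (λ { q∼r (k , u , v , p∼ , q∼ , uv) →
             k , u , v , p∼ , ∼-trans (∼-sym q∼r) q∼ , uv })
      , (λ { p∼r (k , u , v , p∼ , q∼ , uv) →
             k , u , v , ∼-trans (∼-sym p∼r) p∼ , q∼ , uv })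
    ; Adj-sym       = λ { (k , u , v , p∼ , q∼ , uv) → k , v , u , q∼ , p∼ , Adj-sym uv }
    ; Adj-irrefl    = λ { p∼q (k , u , v , p∼ , q∼ , uv) →
        Adj-irrefl (∼-copy (∼-trans (∼-sym p∼) (∼-trans p∼q q∼))) uv }
    ; Adj?          = GluedAdj?
    }

  -- The new contacts x₁, x₂′, x₃″.
  gluedContact : Fin 3 → Copies
  gluedContact i = i , contact i

  gluedContact-distinct : ∀ {i j} → gluedContact i ∼ gluedContact j → i ≡ j
  gluedContact-distinct (same _)    = refl
  gluedContact-distinct (glued e _) = distinct e

  gluedTetrad : Tetrad
  gluedTetrad = record
    { graph    = gluedGraph
    ; contact  = gluedContact
    ; distinct = gluedContact-distinct
    }

tetrad : (n : ℕ) .{{_ : NonZero n}} → Tetrad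
tetrad 1             = triangle
tetrad (suc (suc n)) = Glue.gluedTetrad (tetrad (suc n))

sierpinski : (n : ℕ) .{{_ : NonZero n}} → Graph
sierpinski n = Tetrad.graph (tetrad n)

{-# OPTIONS --safe #-}

-- Colour the small triangles of Sₙ, n ≥ 2, by the position they occupy inside
-- the copy of S₂ containing them.  Triangles of the same colour are disjoint,
-- every vertex misses at least one of the three colours, and every edge lies in
-- a triangle.  So the small triangles form a clique 2-cover, and the three
-- partitions of the vertices into the triangles of one colour and singletons
-- are the coordinates of an embedding of the complement into a product of three
-- complete graphs.
--
-- Conversely S₂ is an induced subgraph of Sₙ.  It contains an induced path of
-- length two, which excludes a clique 1-cover.  In an embedding of the
-- complement into a product of two complete graphs, each edge of Sₙ agrees in
-- one of the two coordinates, so two of the edges of the middle triangle of S₂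
-- agree in the same coordinate; this leaves no admissible coordinates for the
-- two other edges at their common vertex.
module Submission where

open import Defs
open import Data.Bool.Base using (Bool; T; if_then_else_)
open import Data.Bool.Properties using (T-≡)
open import Data.Fin.Base using (Fin; zero; suc; punchOut; combine; funToFin; finToFun)
open import Data.Fin.Patterns using (0F; 1F; 2F)
open import Data.Fin.Properties as Fin using (*↔×; finToFun-funToFin; punchOut-injective)
open import Data.Fin.Subset using (Subset; inside; outside; _∈_; ∣_∣)
open import Data.Fin.Subset.Properties using (x∈p⇒∣p-x∣<∣p∣; x∈p∧x≢y⇒x∈p-y)
open import Data.List.Base using ([]; _∷_; length; lookup)
open import Data.List.NonEmpty using (_∷_)
open import Data.List.Relation.Unary.Any as Any using ()
open import Data.List.Relation.Unary.Any.Properties using (lookup-index)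
open import Data.Nat.Base using (ℕ; zero; suc; _≤_; _<_; z≤n; s≤s; NonZero; _≥_)
open import Data.Nat.Properties using (≤-trans; n≮0; ≤-pred)
open import Data.Product.Base as Prod using (Σ-syntax; ∃-syntax; _×_; _,_; proj₁; proj₂)
open import Data.Product.Function.NonDependent.Propositional using (_×-↔_)
open import Data.Sum.Base as Sum using (_⊎_; inj₁; inj₂)
open import Data.Vec.Base using ([]; _∷_; tabulate; here; there)
open import Data.Vec.Properties using (lookup∘tabulate; lookup⇒[]=; []=⇒lookup)
open import Function.Base using (_∘_; id)
open import Function.Bundles using (Inverse; Equivalence; _⇔_; _↔_; mk⇔)
open import Function.Construct.Composition using (_↔-∘_)
open import Function.Construct.Identity using (↔-id)
open import Level using (0ℓ)
open import Relation.Binary.Core using (Rel)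
open import Relation.Binary.Structures using (IsDecEquivalence)
open import Relation.Binary.PropositionalEquality
  using (_≡_; _≢_; _≗_; refl; sym; trans; cong; cong₂; subst)
open import Relation.Nullary
  using (¬_; Dec; yes; no; does; ¬?; _×-dec_; _⊎-dec_; contradiction; toWitness; fromWitness)
open import Relation.Nullary.Decidable as Dec
  using (⌊_⌋; from-yes; from-no; does-⇔; isYes≗does; decidable-stable)

open Equivalence using (to; from)

-- Counting in finite subsets.

private variable
  m k : ℕ

-- Induction on `p`: a member at the head claims its value of `f`, and `punchOut` removes that value
-- from the codomain left to the other members.
injection⇒∣p∣≤k : {p : Subset m} (f : ∀ {i} → i ∈ p → Fin k) →
                  (∀ {i j} (x : i ∈ p) (y : j ∈ p) → f x ≡ f y → i ≡ j) → ∣ p ∣ ≤ k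
injection⇒∣p∣≤k {p = []}                   f inj = z≤n
injection⇒∣p∣≤k {p = outside ∷ p}          f inj =
  injection⇒∣p∣≤k (f ∘ there) λ x y → Fin.suc-injective ∘ inj (there x) (there y)
injection⇒∣p∣≤k {k = zero}  {inside ∷ p} f inj with () ← f here
injection⇒∣p∣≤k {k = suc k} {inside ∷ p} f inj =
  s≤s (injection⇒∣p∣≤k (λ x → punchOut (apart x)) λ x y →
    Fin.suc-injective ∘ inj (there x) (there y) ∘ punchOut-injective (apart x) (apart y))
  where
    apart : ∀ {i} (x : i ∈ p) → f here ≢ f (there x)
    apart x eq with () ← inj here (there x) eq

-- Two different members could be deleted in turn, each deletion lowering the cardinality, and a
-- bound of 1 leaves no room for that.
∣p∣≤1⇒unique : {p : Subset m} → ∣ p ∣ ≤ 1 → ∀ {i j} → i ∈ p → j ∈ p → i ≡ j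
∣p∣≤1⇒unique ∣p∣≤1 {i} {j} i∈p j∈p = decidable-stable (i Fin.≟ j) λ i≢j →
  n≮0 (≤-trans (x∈p⇒∣p-x∣<∣p∣ (x∈p∧x≢y⇒x∈p-y j∈p (i≢j ∘ sym)))
               (≤-pred (≤-trans (x∈p⇒∣p-x∣<∣p∣ i∈p) ∣p∣≤1)))

∈-tabulate⁺ : (f : Fin m → Bool) → ∀ {i} → T (f i) → i ∈ tabulate f
∈-tabulate⁺ f {i} fi = lookup⇒[]= i _ (trans (lookup∘tabulate f i) (to T-≡ fi))

∈-tabulate⁻ : (f : Fin m → Bool) → ∀ {i} → i ∈ tabulate f → T (f i)
∈-tabulate⁻ f {i} i∈ = from T-≡ (trans (sym (lookup∘tabulate f i)) ([]=⇒lookup i∈))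

funToFin-cong : {f g : Fin m → Fin k} → f ≗ g → funToFin f ≡ funToFin g
funToFin-cong {m = zero}  f≗g = refl
funToFin-cong {m = suc m} f≗g = cong₂ combine (f≗g zero) (funToFin-cong (f≗g ∘ suc))

-- Supplies the missed colour at a vertex whose triangles have only the colours `i` and `j`.
third : (i j : Fin 3) → ∃[ c ] (i ≢ c × j ≢ c)
third = from-yes third?
  where
    third? : Dec (∀ (i j : Fin 3) → ∃[ c ] (i ≢ c × j ≢ c))
    third? = Fin.all? λ i → Fin.all? λ j → Fin.any? λ c →
               ¬? (i Fin.≟ c) ×-dec ¬? (j Fin.≟ c)

-- Vertex sets and quotients by decidable equivalences.

module _ (G : Graph) where
  open Graph G

  decSet : {P : Vertex → Set} → (∀ {u v} → u ≈ v → P u → P v) →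
           (∀ v → Dec (P v)) → VertexSet G
  decSet resp P? = record
    { to   = λ v → ⌊ P? v ⌋
    ; cong = λ {u} {v} u≈v →
        trans (isYes≗does (P? u))
          (trans (does-⇔ (mk⇔ (resp u≈v) (resp (≈-sym u≈v))) (P? u) (P? v))
                 (sym (isYes≗does (P? v))))
    }

  -- The code of v is the characteristic function of its class, read along the
  -- enumeration of the vertices.
  kernel : {_~_ : Rel Vertex 0ℓ} → IsDecEquivalence _~_ → (∀ {u v} → u ≈ v → u ~ v) →
           ∃[ m ] Σ[ f ∈ (Vertex → Fin m) ] (∀ u v → f u ≡ f v ⇔ u ~ v)
  kernel {_~_} isDecEq ≈⇒~ = _ , funToFin ∘ code , λ u v → mk⇔ reflects respects
    where
      module ~ = IsDecEquivalence isDecEq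

      bit : ∀ {A : Set} → Dec A → Fin 2
      bit A? = if does A? then 1F else 0F

      bit⁺ : ∀ {A : Set} (A? : Dec A) → A → bit A? ≡ 1F
      bit⁺ A? a = cong (if_then 1F else 0F) (Dec.dec-true A? a)

      bit⁻ : ∀ {A : Set} (A? : Dec A) → bit A? ≡ 1F → A
      bit⁻ (yes a) _ = a

      code : Vertex → Fin (length enumeration) → Fin 2
      code v i = bit (v ~.≟ lookup enumeration i)

      reflects : ∀ {u v} → funToFin (code u) ≡ funToFin (code v) → u ~ v
      reflects {u} {v} eq = ~.trans u~w (~.sym (≈⇒~ v≈w))
        where
          -- The codes are compared at an entry equal to `v`, where the code of `v` is 1.
          i = Any.index (isEnumeration v)
          v≈w : v ≈ lookup enumeration i
          v≈w = lookup-index (isEnumeration v)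
          u~w : u ~ lookup enumeration i
          u~w = bit⁻ (u ~.≟ _)
            (trans (sym (finToFun-funToFin (code u) i))
            (trans (cong (λ c → finToFun c i) eq)
            (trans (finToFun-funToFin (code v) i)
                   (bit⁺ (v ~.≟ _) (≈⇒~ v≈w)))))

      respects : ∀ {u v} → u ~ v → funToFin (code u) ≡ funToFin (code v)
      respects {u} {v} u~v = funToFin-cong λ i → cong (if_then 1F else 0F)
        (does-⇔ (mk⇔ (~.trans (~.sym u~v)) (~.trans u~v))
                (u ~.≟ lookup enumeration i) (v ~.≟ lookup enumeration i))

-- Induced embeddings.

infix 4 _↪_

-- A vertex map composes and passes to complements more easily than an isomorphism with an induced
-- subgraph.
record _↪_ (G H : Graph) : Set where
  private
    module G = Graph G
    module H = Graph H
  field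
    map       : G.Vertex → H.Vertex
    map-cong  : ∀ {u v} → u G.≈ v → map u H.≈ map v
    injective : ∀ {u v} → map u H.≈ map v → u G.≈ v
    adjacency : ∀ u v → G.Adj u v ⇔ H.Adj (map u) (map v)

↪-refl : ∀ {G} → G ↪ G
↪-refl = record
  { map = id ; map-cong = id ; injective = id ; adjacency = λ _ _ → mk⇔ id id }

↪-trans : ∀ {G H K} → G ↪ H → H ↪ K → G ↪ K
↪-trans e f = record
  { map       = F.map ∘ E.map
  ; map-cong  = F.map-cong ∘ E.map-cong
  ; injective = E.injective ∘ F.injective
  ; adjacency = λ u v → mk⇔
      (to (F.adjacency _ _) ∘ to (E.adjacency u v))
      (from (E.adjacency u v) ∘ from (F.adjacency _ _))
  }
  where
    module E = _↪_ e
    module F = _↪_ f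

↪-complement : ∀ {G H} → G ↪ H → complement G ↪ complement H
↪-complement e = record
  { map       = map
  ; map-cong  = map-cong
  ; injective = injective
  ; adjacency = λ u v → mk⇔
      (λ (u≉v , ¬uv) → u≉v ∘ injective , ¬uv ∘ from (adjacency u v))
      (λ (u≉v , ¬uv) → u≉v ∘ map-cong , ¬uv ∘ to (adjacency u v))
  }
  where open _↪_ e

≅induced⇒↪ : ∀ {G} H U → G ≅ induced H U → G ↪ H
≅induced⇒↪ {G} H U iso = record
  { map       = proj₁ ∘ B.to
  ; map-cong  = B.to-cong
  ; injective = λ e → ≈-trans (≈-sym (B.strictlyInverseʳ _))
                        (≈-trans (B.from-cong e) (B.strictlyInverseʳ _))
  ; adjacency = _≅_.adjacency iso
  }
  where
    module B = Inverse (_≅_.bijection iso)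
    open Graph G

↪⇒≅induced : ∀ {G} H → G ↪ H → Σ[ U ∈ VertexSet H ] G ≅ induced H U
↪⇒≅induced {G} H e = image , record
  { bijection = record
    { to        = λ v → map v , fromWitness (v , H.≈-refl)
    ; from      = λ (_ , p) → proj₁ (toWitness p)
    ; to-cong   = map-cong
    ; from-cong = λ {(_ , p)} {(_ , q)} x≈y → injective
        (H.≈-trans (proj₂ (toWitness p)) (H.≈-trans x≈y (H.≈-sym (proj₂ (toWitness q)))))
    ; inverse   =
        (λ {(_ , p)} v≈ → H.≈-trans (map-cong v≈) (proj₂ (toWitness p)))
      , (λ {_} {(_ , p)} x≈ → injective (H.≈-trans (proj₂ (toWitness p)) x≈))
    }
  ; adjacency = adjacency
  }
  where
    open _↪_ e
    module G = Graph G
    module H = Graph H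

    InImage : H.Vertex → Set
    InImage x = Σ[ v ∈ G.Vertex ] map v H.≈ x

    inImage? : ∀ x → Dec (InImage x)
    inImage? x = G.any-vertex? (λ u≈v e → H.≈-trans (map-cong (G.≈-sym u≈v)) e)
                               (λ v → map v H.≟ x)

    image : VertexSet H
    image = decSet H (λ x≈y (v , e) → v , H.≈-trans e x≈y) inImage?

-- Coloured small triangles and their behaviour under gluing.

-- `contact-colour` controls gluing: where contact `j` of copy `i` meets contact `i` of copy `j`,
-- the triangles have colour `j` in copy `i` and colour `i` in copy `j`.
record Triangulation (𝒯 : Tetrad) : Set₁ where
  open Tetrad 𝒯
  open Graph graph
  field
    Triangle : Set
    size     : ℕ
    indexing : Fin size ↔ Triangle
    corner   : Triangle → Fin 3 → Vertex
    colour   : Triangle → Fin 3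

  infix 4 _∈ₜ_

  _∈ₜ_ : Vertex → Triangle → Set
  v ∈ₜ t = ∃[ j ] v ≈ corner t j

  field
    corner-adj      : ∀ {t i j} → i ≢ j → Adj (corner t i) (corner t j)
    adj-covered     : ∀ {u v} → Adj u v → ∃[ t ] (u ∈ₜ t × v ∈ₜ t)
    colour-disjoint : ∀ {v t s} → v ∈ₜ t → v ∈ₜ s → colour t ≡ colour s → t ≡ s
    linear          : ∀ {u v t s} → u ∈ₜ t → v ∈ₜ t → u ∈ₜ s → v ∈ₜ s → t ≡ s ⊎ u ≈ v
    avoided-colour  : ∀ v → ∃[ c ] (∀ {t} → v ∈ₜ t → colour t ≢ c)
    contact-colour  : ∀ {i t} → contact i ∈ₜ t → colour t ≡ i

module _ (𝒯 : Tetrad) where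
  open Tetrad 𝒯
  open Graph graph
  open Glue 𝒯

  glue-triangulation : Triangulation 𝒯 → Triangulation gluedTetrad
  glue-triangulation D = record
    { Triangle        = Fin 3 × D.Triangle
    ; size            = _
    ; indexing        = (↔-id _ ×-↔ D.indexing) ↔-∘ *↔×
    ; corner          = λ (k , t) j → k , D.corner t j
    ; colour          = λ (_ , t) → D.colour t
    ; corner-adj      = λ {(k , _)} i≢j → k , _ , _ , ∼-refl , ∼-refl , D.corner-adj i≢j
    ; adj-covered     = covered
    ; colour-disjoint = λ (_ , p) (_ , q) → disjoint (∼-trans (∼-sym p) q)
    ; linear          = λ (_ , p) (_ , q) (_ , p′) (_ , q′) → linear p p′ q q′
    ; avoided-colour  = λ p → proj₁ (avoided p) , λ q → proj₂ (avoided p) q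
    ; contact-colour  = λ (_ , p) → contact-colour p
    }
    where
      module D = Triangulation D

      covered : ∀ {p q} → GluedAdj p q →
                ∃[ (k , t) ] ((∃[ j ] p ∼ (k , D.corner t j)) × (∃[ j ] q ∼ (k , D.corner t j)))
      covered (k , _ , _ , p∼ , q∼ , uv) with D.adj-covered uv
      ... | t , (i , u≈) , (j , v≈) =
        (k , t) , (i , ∼-trans p∼ (same u≈)) , (j , ∼-trans q∼ (same v≈))

      disjoint : ∀ {k l t s a b} → (k , D.corner t a) ∼ (l , D.corner s b) →
                 D.colour t ≡ D.colour s → (k , t) ≡ (l , s)
      disjoint {k} (same e) eq = cong (k ,_) (D.colour-disjoint (_ , ≈-refl) (_ , e) eq)
      -- Here `t` touches contact `l` and `s` touches contact `k`, so their colours are `l` and `k`;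
      -- equal colours force the copies to coincide.
      disjoint {k} {l} {t} {s} (glued e f) eq
        with refl ← trans (sym (D.contact-colour (_ , ≈-sym f)))
                          (trans (sym eq) (D.contact-colour (_ , ≈-sym e))) =
        cong (k ,_) (D.colour-disjoint (_ , ≈-sym e) (_ , ≈-sym f) eq)

      linear : ∀ {p q k l t s a b a′ b′} →
               p ∼ (k , D.corner t a) → p ∼ (l , D.corner s b) →
               q ∼ (k , D.corner t a′) → q ∼ (l , D.corner s b′) →
               (k , t) ≡ (l , s) ⊎ p ∼ q
      linear {p} {q} {k} {l} {t} {s} {a} {b} {a′} {b′} p∼t p∼s q∼t q∼s =
        link (∼-trans (∼-sym p∼t) p∼s) (∼-trans (∼-sym q∼t) q∼s)
        where
          agree : D.corner t a ≈ D.corner t a′ → p ∼ q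
          agree e = ∼-trans p∼t (∼-trans (same e) (∼-sym q∼t))

          inCopy : k ≡ l → D.corner t a ≈ D.corner s b → D.corner t a′ ≈ D.corner s b′ →
                   (k , t) ≡ (l , s) ⊎ p ∼ q
          inCopy refl e f with D.linear (_ , ≈-refl) (_ , ≈-refl) (_ , e) (_ , f)
          ... | inj₁ t≡s = inj₁ (cong (k ,_) t≡s)
          ... | inj₂ a≈a′ = inj₂ (agree a≈a′)

          link : (k , D.corner t a) ∼ (l , D.corner s b) →
                 (k , D.corner t a′) ∼ (l , D.corner s b′) →
                 (k , t) ≡ (l , s) ⊎ p ∼ q
          link (same e)     f            = inCopy refl e (∼-copy f)
          link (glued e e′) (same f)     = inCopy refl (≈-trans e (≈-sym e′)) f
          -- Both corners of `t` are contact `l`, the only vertex of copy `k` glued to copy `l`.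
          link (glued e e′) (glued f f′) = inj₂ (agree (≈-trans e (≈-sym f)))

      avoided : ∀ p → ∃[ c ] (∀ {k t} → ∃[ j ] p ∼ (k , D.corner t j) → D.colour t ≢ c)
      avoided (i , u) with Fin.any? (λ j → u ≟ contact j)
      -- Triangles at this vertex have colour `j` inside copy `i` and colour `i` across the gluing,
      -- so `c` differs from both.
      ... | yes (j , u≈) = c , λ
        { (_ , same e)    eq → j≢c (trans (sym (D.contact-colour (_ , ≈-trans (≈-sym u≈) e))) eq)
        ; (_ , glued e f) eq → i≢c (trans (sym (D.contact-colour (_ , ≈-sym f))) eq) }
        where
          c = proj₁ (third i j)
          i≢c = proj₁ (proj₂ (third i j))
          j≢c = proj₂ (proj₂ (third i j))
      ... | no u≉ = proj₁ (D.avoided-colour u) , λ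
        { (_ , same e)    → proj₂ (D.avoided-colour u) (_ , e)
        ; (_ , glued e f) → contradiction (_ , e) u≉ }

      contact-colour : ∀ {i k t j} → (i , contact i) ∼ (k , D.corner t j) → D.colour t ≡ i
      contact-colour (same e) = D.contact-colour (_ , e)
      contact-colour (glued e f) with refl ← distinct e = D.contact-colour (_ , ≈-sym f)

  -- No edge is added between vertices of one copy: another copy shares a single vertex with it,
  -- while an edge needs two.
  copy-↪ : graph ↪ gluedGraph
  copy-↪ = record
    { map       = 0F ,_
    ; map-cong  = same
    ; injective = ∼-copy
    ; adjacency = λ u v → mk⇔ (λ uv → 0F , u , v , ∼-refl , ∼-refl , uv)
        λ { (_ , _ , _ , p∼ , q∼ , uv) → reflect p∼ q∼ uv }
    }
    where
      reflect : ∀ {i k u u′ v v′} → (i , u) ∼ (k , u′) → (i , v) ∼ (k , v′) →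
                Adj u′ v′ → Adj u v
      reflect (same e)    q           uv =
        proj₁ Adj-resp (≈-sym (∼-copy q)) (proj₂ Adj-resp (≈-sym e) uv)
      reflect (glued e f) (same g)    uv =
        proj₁ Adj-resp (≈-sym g) (proj₂ Adj-resp (≈-sym (≈-trans e (≈-sym f))) uv)
      reflect (glued _ f) (glued _ g) uv =
        contradiction uv (Adj-irrefl (≈-trans f (≈-sym g)))

-- The induction starts at 2 because the single triangle of the first gasket contains all three
-- contacts, which contradicts `contact-colour`.
triangulation₂ : Triangulation (tetrad 2)
triangulation₂ = record
  { Triangle        = Fin 3
  ; size            = 3
  ; indexing        = ↔-id _
  ; corner          = _,_
  ; colour          = id
  ; corner-adj      = λ {t} i≢j → t , _ , _ , ∼-refl , ∼-refl , i≢j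
  ; adj-covered     = λ { (k , _ , _ , u∼ , v∼ , _) → k , (_ , u∼) , (_ , v∼) }
  ; colour-disjoint = λ _ _ t≡s → t≡s
  ; linear          = linear
  -- The vertex `(i , j)` lies only in the triangles `i` and `j`.
  ; avoided-colour  = λ (i , j) → proj₁ (third i j) , λ
      { (_ , same _)    → proj₁ (proj₂ (third i j))
      ; (_ , glued e _) → proj₂ (proj₂ (third i j)) ∘ trans e }
  ; contact-colour  = λ { (_ , same _) → refl ; (_ , glued e _) → sym e }
  }
  where
    open Glue triangle

    linear : ∀ {p q t s} → ∃[ a ] p ∼ (t , a) → ∃[ a ] q ∼ (t , a) →
             ∃[ b ] p ∼ (s , b) → ∃[ b ] q ∼ (s , b) → t ≡ s ⊎ p ∼ q
    linear (a , p∼t) (a′ , q∼t) (_ , p∼s) (_ , q∼s)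
      with ∼-trans (∼-sym p∼t) p∼s | ∼-trans (∼-sym q∼t) q∼s
    ... | same _       | _            = inj₁ refl
    ... | glued _ _    | same _       = inj₁ refl
    ... | glued refl _ | glued refl _ = inj₂ (∼-trans p∼t (∼-sym q∼t))

triangulation : ∀ n → Triangulation (tetrad (suc (suc n)))
triangulation zero    = triangulation₂
triangulation (suc n) = glue-triangulation _ (triangulation n)

S₂↪ : ∀ n → sierpinski 2 ↪ sierpinski (suc (suc n))
S₂↪ zero    = ↪-refl
S₂↪ (suc n) = ↪-trans (S₂↪ n) (copy-↪ (tetrad (suc (suc n))))

-- Upper bounds: the clique cover and the product embedding.

module _ {𝒯 : Tetrad} (D : Triangulation 𝒯) where
  open Triangulation D
  open Graph (Tetrad.graph 𝒯)
  private
    G = Tetrad.graph 𝒯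
    module I = Inverse indexing

  ∈ₜ-resp : ∀ {u v t} → u ≈ v → u ∈ₜ t → v ∈ₜ t
  ∈ₜ-resp u≈v (j , u≈) = j , ≈-trans (≈-sym u≈v) u≈

  ∈ₜ? : ∀ v t → Dec (v ∈ₜ t)
  ∈ₜ? v t = Fin.any? λ j → v ≟ corner t j

  ∈ₜ-clique : ∀ {u v t} → u ∈ₜ t → v ∈ₜ t → ¬ u ≈ v → Adj u v
  ∈ₜ-clique {t = t} (i , u≈) (j , v≈) u≉v =
    proj₁ Adj-resp (≈-sym v≈) (proj₂ Adj-resp (≈-sym u≈) (corner-adj λ i≡j →
      u≉v (≈-trans u≈ (subst (λ i → corner t i ≈ _) (sym i≡j) (≈-sym v≈)))))

  cliqueCover : CliqueCover G 2
  cliqueCover = record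
    { size     = size
    ; clique   = λ i → decSet G ∈ₜ-resp (λ v → ∈ₜ? v (I.to i))
    ; isClique = λ i u∈ v∈ → ∈ₜ-clique (toWitness u∈) (toWitness v∈)
    ; covers   = λ uv → let t , u∈t , v∈t = adj-covered uv in
        I.from t , fromWitness (subst (_ ∈ₜ_) (sym (I.strictlyInverseˡ t)) u∈t)
                 , fromWitness (subst (_ ∈ₜ_) (sym (I.strictlyInverseˡ t)) v∈t)
    ; bounded  = bounded
    }
    where
      bounded : ∀ v → ∣ tabulate (λ i → ⌊ ∈ₜ? v (I.to i) ⌋) ∣ ≤ 2
      bounded v = injection⇒∣p∣≤k
        -- Triangles through `v` are told apart by their colours, and deleting the avoided colour
        -- leaves two values.
        (λ i∈ → punchOut (avoid (member i∈) ∘ sym))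
        (λ {i} {j} i∈ j∈ eq → trans (sym (I.strictlyInverseʳ i)) (trans
          (cong I.from (colour-disjoint (member i∈) (member j∈)
            (punchOut-injective (avoid (member i∈) ∘ sym) (avoid (member j∈) ∘ sym) eq)))
          (I.strictlyInverseʳ j)))
        where
          avoid = proj₂ (avoided-colour v)
          member : ∀ {i} → i ∈ tabulate (λ i → ⌊ ∈ₜ? v (I.to i) ⌋) → v ∈ₜ I.to i
          member i∈ = toWitness (∈-tabulate⁻ _ i∈)

  SameClass : Fin 3 → Rel Vertex 0ℓ
  SameClass c u v = u ≈ v ⊎ ∃[ t ] (colour t ≡ c × u ∈ₜ t × v ∈ₜ t)

  -- Transitivity rests on disjointness: two triangles of colour `c` with a common vertex coincide.
  sameClass-isDecEquivalence : ∀ c → IsDecEquivalence (SameClass c)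
  sameClass-isDecEquivalence c = record
    { isEquivalence = record
      { refl  = inj₁ ≈-refl
      ; sym   = λ { (inj₁ e) → inj₁ (≈-sym e)
                  ; (inj₂ (t , eq , u∈ , v∈)) → inj₂ (t , eq , v∈ , u∈) }
      ; trans = transitive
      }
    ; _≟_ = λ u v → (u ≟ v) ⊎-dec Dec.map′
        (λ (i , p) → I.to i , p)
        (λ (t , p) → I.from t ,
          subst (λ t → colour t ≡ c × u ∈ₜ t × v ∈ₜ t) (sym (I.strictlyInverseˡ t)) p)
        (Fin.any? λ i → (colour (I.to i) Fin.≟ c) ×-dec ∈ₜ? u (I.to i) ×-dec ∈ₜ? v (I.to i))
    }
    where
      transitive : ∀ {u v w} → SameClass c u v → SameClass c v w → SameClass c u w
      transitive (inj₁ e) (inj₁ f) = inj₁ (≈-trans e f)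
      transitive (inj₁ e) (inj₂ (t , eq , v∈ , w∈)) = inj₂ (t , eq , ∈ₜ-resp (≈-sym e) v∈ , w∈)
      transitive (inj₂ (t , eq , u∈ , v∈)) (inj₁ e) = inj₂ (t , eq , u∈ , ∈ₜ-resp e v∈)
      transitive (inj₂ (t , eq , u∈ , v∈)) (inj₂ (s , eq′ , v∈′ , w∈))
        with refl ← colour-disjoint v∈ v∈′ (trans eq (sym eq′)) = inj₂ (t , eq , u∈ , w∈)

  -- Two colours already suffice: distinct vertices sharing a triangle of each would, by `linear`,
  -- give one triangle two colours.
  sameClass⇒≈ : ∀ {u v} → (∀ c → SameClass c u v) → u ≈ v
  sameClass⇒≈ same with same 0F | same 1F
  ... | inj₁ e | _ = e
  ... | _ | inj₁ e = e
  ... | inj₂ (_ , t≡0 , u∈ , v∈) | inj₂ (_ , s≡1 , u∈′ , v∈′) with linear u∈ v∈ u∈′ v∈′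
  ...   | inj₂ e = e
  ...   | inj₁ refl with () ← trans (sym t≡0) s≡1

  complement⇔ : ∀ {u v} → (¬ u ≈ v × ¬ Adj u v) ⇔ (∀ c → ¬ SameClass c u v)
  complement⇔ = mk⇔
    (λ { (u≉v , _)   _ (inj₁ u≈v)                → u≉v u≈v
       ; (u≉v , ¬uv) _ (inj₂ (_ , _ , u∈ , v∈)) → ¬uv (∈ₜ-clique u∈ v∈ u≉v) })
    (λ apart → apart 0F ∘ inj₁
             , λ uv → let t , u∈ , v∈ = adj-covered uv in
                      apart (colour t) (inj₂ (t , refl , u∈ , v∈)))

  complement-inducedInProduct : InducedInProduct (complement G) 3
  complement-inducedInProduct =
    size′ 0F ∷ size′ 1F ∷ size′ 2F ∷ [] , refl ,
    ↪⇒≅induced (complete (size′ 0F) ×ᶜ complete (size′ 1F) ×ᶜ complete (size′ 2F)) record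
      { map       = λ v → f 0F v , f 1F v , f 2F v
      ; map-cong  = λ e → agree 0F e , agree 1F e , agree 2F e
      ; injective = λ (p , q , r) → sameClass⇒≈ λ
          { 0F → to (f-kernel 0F _ _) p
          ; 1F → to (f-kernel 1F _ _) q
          ; 2F → to (f-kernel 2F _ _) r }
      ; adjacency = λ u v → mk⇔
          (λ uv → let apart = λ c → to complement⇔ uv c ∘ to (f-kernel c u v) in
                  apart 0F , apart 1F , apart 2F)
          (λ (p , q , r) → from complement⇔ λ
            { 0F → p ∘ from (f-kernel 0F u v)
            ; 1F → q ∘ from (f-kernel 1F u v)
            ; 2F → r ∘ from (f-kernel 2F u v) })
      }
    where
      colouring : ∀ c → ∃[ m ] Σ[ f ∈ (Vertex → Fin m) ] (∀ u v → f u ≡ f v ⇔ SameClass c u v)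
      colouring c = kernel G (sameClass-isDecEquivalence c) inj₁

      size′ : Fin 3 → ℕ
      size′ c = proj₁ (colouring c)

      f : ∀ c → Vertex → Fin (size′ c)
      f c = proj₁ (proj₂ (colouring c))

      f-kernel : ∀ c u v → f c u ≡ f c v ⇔ SameClass c u v
      f-kernel c = proj₂ (proj₂ (colouring c))

      agree : ∀ c {u v} → u ≈ v → f c u ≡ f c v
      agree c e = from (f-kernel c _ _) (inj₁ e)

-- Lower bounds from the induced second gasket.

module S₂ = Graph (sierpinski 2)
module S₂ᶜ = Graph (complement (sierpinski 2))

-- What remains of an embedding of the complement of S₂ into a product of two
-- complete graphs when only its coordinate functions are kept.
record Coordinates {A B : Set} (f : S₂.Vertex → A) (g : S₂.Vertex → B) : Set where
  field
    edge    : ∀ {u v} → S₂.Adj u v → f u ≡ f v ⊎ g u ≡ g v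
    nonedge : ∀ {u v} → S₂ᶜ.Adj u v → f u ≢ f v × g u ≢ g v

swap : ∀ {A B} {f : S₂.Vertex → A} {g : S₂.Vertex → B} → Coordinates f g → Coordinates g f
swap co = record
  { edge    = λ uv → Sum.swap (edge uv)
  ; nonedge = λ uv → Prod.swap (nonedge uv)
  }
  where open Coordinates co

-- The edges from the midpoint (0 , 1) to the contacts (0 , 0) and (1 , 1) would
-- both have to agree in g.
not-monochromatic : ∀ {A B} {f : S₂.Vertex → A} {g : S₂.Vertex → B} → Coordinates f g →
                    f (0F , 1F) ≡ f (0F , 2F) → f (0F , 1F) ≢ f (1F , 2F)
not-monochromatic co ab ac
  with Coordinates.edge co (from-yes (S₂.Adj? (0F , 0F) (0F , 1F)))
     | Coordinates.edge co (from-yes (S₂.Adj? (1F , 1F) (0F , 1F)))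
-- Agreement in `f` would identify the contact `(0 , 0)` in that coordinate with the opposite
-- midpoint `(1 , 2)`, a nonneighbour; likewise for `(1 , 1)` and `(0 , 2)`.
... | inj₁ xa | _       =
  proj₁ (Coordinates.nonedge co (from-yes (S₂ᶜ.Adj? (0F , 0F) (1F , 2F)))) (trans xa ac)
... | inj₂ _  | inj₁ ya =
  proj₁ (Coordinates.nonedge co (from-yes (S₂ᶜ.Adj? (1F , 1F) (0F , 2F)))) (trans ya ab)
... | inj₂ xa | inj₂ ya =
  proj₂ (Coordinates.nonedge co (from-yes (S₂ᶜ.Adj? (0F , 0F) (1F , 1F)))) (trans xa (sym ya))

-- By pigeonhole two edges of the middle triangle agree in the same coordinate, which is then
-- constant on the triangle by transitivity.
¬coordinates : ∀ {A B} {f : S₂.Vertex → A} {g : S₂.Vertex → B} → ¬ Coordinates f g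
¬coordinates co
  with Coordinates.edge co (from-yes (S₂.Adj? (0F , 1F) (0F , 2F)))
     | Coordinates.edge co (from-yes (S₂.Adj? (0F , 1F) (1F , 2F)))
     | Coordinates.edge co (from-yes (S₂.Adj? (0F , 2F) (1F , 2F)))
... | inj₁ ab | inj₁ ac | _       = not-monochromatic co ab ac
... | inj₁ ab | inj₂ _  | inj₁ bc = not-monochromatic co ab (trans ab bc)
... | inj₁ _  | inj₂ ac | inj₂ bc = not-monochromatic (swap co) (trans ac (sym bc)) ac
... | inj₂ _  | inj₁ ac | inj₁ bc = not-monochromatic co (trans ac (sym bc)) ac
... | inj₂ ab | inj₁ _  | inj₂ bc = not-monochromatic (swap co) ab (trans ab bc)
... | inj₂ ab | inj₂ ac | _       = not-monochromatic (swap co) ab ac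

-- Nonadjacency in the complement only refutes that both coordinates differ; decidable equality in
-- `Fin` extracts an agreement.
coordinates : ∀ {m k} {f : S₂.Vertex → Fin m} {g : S₂.Vertex → Fin k} →
              (∀ u v → S₂ᶜ.Adj u v ⇔ (f u ≢ f v × g u ≢ g v)) → Coordinates f g
coordinates {f = f} {g} adj = record
  { edge    = λ {u} {v} uv → decidable-stable ((f u Fin.≟ f v) ⊎-dec (g u Fin.≟ g v))
      λ differ → proj₂ (from (adj u v) (differ ∘ inj₁ , differ ∘ inj₂)) uv
  ; nonedge = to (adj _ _)
  }

module _ {G : Graph} (e : sierpinski 2 ↪ G) where
  private
    module E = _↪_ e

    x a y : S₂.Vertex
    x = 0F , 0F
    a = 0F , 1F
    y = 1F , 1F

  ¬1-cover : ¬ CliqueCover G 1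
  ¬1-cover record { covers = covers ; isClique = isClique ; bounded = bounded }
    with covers (to (E.adjacency x a) (from-yes (S₂.Adj? x a)))
       | covers (to (E.adjacency a y) (from-yes (S₂.Adj? a y)))
  ... | i , x∈i , a∈i | j , a∈j , y∈j
    -- Both cliques contain the image of `a`, so they are one clique, which makes the images of `x`
    -- and `y` adjacent.
    with refl ← ∣p∣≤1⇒unique (bounded (E.map a)) {i} {j}
                  (∈-tabulate⁺ _ a∈i) (∈-tabulate⁺ _ a∈j) =
    from-no (S₂.Adj? x y)
      (from (E.adjacency x y) (isClique i x∈i y∈j (from-no (x S₂.≟ y) ∘ E.injective)))

  cover-bound : ∀ j → 0 < j → CliqueCover G j → 2 ≤ j
  cover-bound 1             _ C = contradiction C ¬1-cover
  cover-bound (suc (suc j)) _ _ = s≤s (s≤s z≤n)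

  product-bound : ∀ j → 0 < j → InducedInProduct (complement G) j → 3 ≤ j
  -- A single factor reduces to two by using its coordinate twice.
  product-bound _ _ (m ∷ [] , _ , U , iso) =
    contradiction
      (coordinates λ u v → mk⇔ (λ uv → to (F.adjacency u v) uv , to (F.adjacency u v) uv)
                               (from (F.adjacency u v) ∘ proj₁))
      ¬coordinates
    where module F = _↪_ (↪-trans (↪-complement e) (≅induced⇒↪ (complete m) U iso))
  product-bound _ _ (m ∷ k ∷ [] , _ , U , iso) =
    contradiction (coordinates F.adjacency) ¬coordinates
    where module F = _↪_ (↪-trans (↪-complement e) (≅induced⇒↪ (complete m ×ᶜ complete k) U iso))
  product-bound _ _ (_ ∷ _ ∷ _ ∷ _ , refl , _) = s≤s (s≤s (s≤s z≤n))

proposition7 : (n : ℕ) .{{_ : NonZero n}} → n ≥ 2 →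
    IsFractal (sierpinski n) × IsDimL (sierpinski n) 1 × IsDimH (sierpinski n) 2
proposition7 (suc (suc n)) (s≤s (s≤s _)) =
  (1 , 2 , dimL , dimH , s≤s (s≤s z≤n)) , dimL , dimH
  where
    dimL : IsDimL (sierpinski (suc (suc n))) 1
    dimL = 2 , (s≤s z≤n , cliqueCover (triangulation n) , cover-bound (S₂↪ n)) , refl

    dimH : IsDimH (sierpinski (suc (suc n))) 2
    dimH = 3 , (s≤s z≤n , complement-inducedInProduct (triangulation n) , product-bound (S₂↪ n)) , refl
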